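{- Let $\mathcal{P}$ be a parametrised propositional logic program over a finite alphabet $\Sigma=\Sigma_p\cup\Sigma_d$. Then (1) $\Psi_{\mathcal{P}}$ is an approximator of $\mathcal{T}_{\mathcal{P}}$; and (2) for every $\Sigma_p$-interpretation $I$, $\Psi^I_{\mathcal{P}}\circ\pi_I^2=\pi_I^2\circ\Psi_{\mathcal{P}}$.
   Context: A parametrised logic program is a finite set of rules $h\leftarrow l_1\wedge\dots\wedge l_n$ with $h\in\Sigma_d$ and each $l_i$ an atom of $\Sigma$ or its negation. For $q\in\Sigma_d$, $\varphi_q$ is the disjunction of the bodies of the rules with head $q$. $L_p$: equivalence classes $\overline\varphi$ of propositional formulas over $\Sigma_p$ ordered by entailment; $L^d_p$: maps $\Sigma_d\to L_p$ ordered pointwise. For $\mathcal{S}=(\mathcal{A}_t,\mathcal{A}_p)\in(L^d_p)^2$, $\varphi^{\mathcal{S}}\in L_p^2$ is defined by: $q^{\mathcal{S}}=(\overline q,\overline q)$ for $q\in\Sigma_p$; $q^{\mathcal{S}}=(\mathcal{A}_t(q),\mathcal{A}_p(q))$ for $q\in\Sigma_d$; $\wedge,\vee$ componentwise; $(\neg\psi)^{\mathcal{S}}=(\overline{\neg\psi_p},\overline{\neg\psi_t})$ when $\psi^{\mathcal{S}}=(\overline{\psi_t},\overline{\psi_p})$. $\Psi_{\mathcal{P}}:(L^d_p)^2\to(L^d_p)^2$ is given by $\Psi_{\mathcal{P}}(\mathcal{S})(q)=\varphi_q^{\mathcal{S}}$ (read componentwise), and $\mathcal{T}_{\mathcal{P}}:L^d_p\to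 L^d_p$ by $\mathcal{T}_{\mathcal{P}}(\mathcal{A})(q)=$ the common component of $\varphi_q^{(\mathcal{A},\mathcal{A})}$. An approximator of an operator $O$ on a complete lattice $L$ is a $\leq_p$-monotone $A:L^2\to L^2$ (precision order $(x,y)\leq_p(u,v)$ iff $x\leq u,v\leq y$) with $A(x,x)_1\leq O(x)\leq A(x,x)_2$. For $I\in 2^{\Sigma_p}$, $\pi_I:L^d_p\to 2^{\Sigma_d}$ maps $\mathcal{A}$ to $\{a\mid\mathcal{A}(a)\text{ is true in }I\}$ and $\pi_I^2(\mathcal{A}_1,\mathcal{A}_2)=(\pi_I(\mathcal{A}_1),\pi_I(\mathcal{A}_2))$. $\Psi^I_{\mathcal{P}}$ is Fitting's operator on pairs $(J_1,J_2)$ of $\Sigma_d$-interpretations with $\Sigma_p$ fixed to $I$: $\Psi^I_{\mathcal{P}}(J_1,J_2)_1=\{q\mid$ some rule body for $q$ is true in Kleene three-valued evaluation$\}$, $\Psi^I_{\mathcal{P}}(J_1,J_2)_2=\{q\mid$ some rule body for $q$ is not false$\}$ (for general pairs the same evaluation with negation swapping and negating the two components). -}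

module Defs where

open import Data.Bool as Bool using (Bool; true; false)
open import Data.Fin using (Fin; zero; suc)
import Data.Fin as Fin
open import Data.Fin.Subset using (Subset)
open import Data.List using (List; []; _∷_; map; filter; foldr; cartesianProductWith)
open import Data.List.Membership.Propositional using (_∈_)
open import Data.List.Membership.Propositional.Properties using (∈-map⁺; ∈-map⁻; ∈-filter⁺; ∈-filter⁻; ∈-cartesianProductWith⁺)
open import Data.List.Relation.Unary.Any using (any?; here; there)
open import Data.Nat using (ℕ; zero; suc)
open import Data.Product using (∃; _×_; _,_; proj₁; proj₂)
open import Data.Sum using (_⊎_; inj₁; inj₂)
open import Data.Vec using ([]; _∷_; lookup; tabulate)
open import Data.Vec.Properties using (tabulate-cong)
import Data.Vec.Functional as F
open import Function using (_∘_; Func)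
open import Level using (0ℓ)
open import Relation.Binary using (Poset; _Respects_; _Preserves_⟶_)
open import Relation.Binary.PropositionalEquality using (_≡_; refl; sym; trans; cong; cong₂)
open import Relation.Nullary using (does; _×-dec_)
open import Relation.Unary using (Pred; Decidable)

module _ (P : Poset 0ℓ 0ℓ 0ℓ) where
  open Poset P

  IsSupremum : Pred Carrier 0ℓ → Carrier → Set
  IsSupremum S s = (∀ x → S x → x ≤ s) × (∀ y → (∀ x → S x → x ≤ y) → s ≤ y)

  IsInfimum : Pred Carrier 0ℓ → Carrier → Set
  IsInfimum S s = (∀ x → S x → s ≤ x) × (∀ y → (∀ x → S x → y ≤ x) → y ≤ s)

-- Subsets are predicates respecting the setoid equality.  Decidability of the
-- subset is a constructive proviso (it is vacuous classically): already in the
-- two-element lattice, suprema of arbitrary subsets give weak excluded middle.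
record CompleteLattice : Set₁ where
  field
    poset    : Poset 0ℓ 0ℓ 0ℓ
  open Poset poset public
  field
    supremum : {S : Pred Carrier 0ℓ} → Decidable S → S Respects _≈_ → ∃ (IsSupremum poset S)
    infimum  : {S : Pred Carrier 0ℓ} → Decidable S → S Respects _≈_ → ∃ (IsInfimum poset S)

  setoid = Poset.Eq.setoid poset

  infix 4 _≤ₚ_
  _≤ₚ_ : Carrier × Carrier → Carrier × Carrier → Set
  (x , y) ≤ₚ (u , v) = x ≤ u × v ≤ y

Operator : CompleteLattice → Set
Operator L = Func (CompleteLattice.setoid L) (CompleteLattice.setoid L)

record IsApproximator (L : CompleteLattice)
                      (A : CompleteLattice.Carrier L × CompleteLattice.Carrier L →
                           CompleteLattice.Carrier L × CompleteLattice.Carrier L)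
                      (O : Operator L) : Set where
  open CompleteLattice L
  open Func O using (to)
  field
    monotone : A Preserves _≤ₚ_ ⟶ _≤ₚ_
    lower    : ∀ x → proj₁ (A (x , x)) ≤ to x
    upper    : ∀ x → to x ≤ proj₂ (A (x , x))

infix  8 ¬_
infixr 7 _∧_
infixr 6 _∨_

data Formula (A : Set) : Set where
  atom    : A → Formula A
  ⊤ ⊥     : Formula A
  _∧_ _∨_ : Formula A → Formula A → Formula A
  ¬_      : Formula A → Formula A

⋀ ⋁ : ∀ {A} → List (Formula A) → Formula A
⋀ = foldr _∧_ ⊤
⋁ = foldr _∨_ ⊥

eval : ∀ {m} → Subset m → Formula (Fin m) → Bool
eval I (atom a) = lookup I a
eval I ⊤        = true
eval I ⊥        = false
eval I (φ ∧ ψ)  = eval I φ Bool.∧ eval I ψ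
eval I (φ ∨ ψ)  = eval I φ Bool.∨ eval I ψ
eval I (¬ φ)    = Bool.not (eval I φ)

infix 4 _⊨_ _⊫_ _≋_

_⊨_ : ∀ {m} → Subset m → Formula (Fin m) → Set
I ⊨ φ = eval I φ ≡ true

_⊫_ _≋_ : ∀ {m} → Formula (Fin m) → Formula (Fin m) → Set
φ ⊫ ψ = ∀ I → I ⊨ φ → I ⊨ ψ
φ ≋ ψ = ∀ I → eval I φ ≡ eval I ψ

≋⇒⊫ : ∀ {m} (φ ψ : Formula (Fin m)) → φ ≋ ψ → φ ⊫ ψ
≋⇒⊫ φ ψ e I t = trans (sym (e I)) t

⊫-antisym : ∀ {m} (φ ψ : Formula (Fin m)) → φ ⊫ ψ → ψ ⊫ φ → φ ≋ ψ
⊫-antisym φ ψ p q I with eval I φ in e | eval I ψ in f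
... | true  | true  = refl
... | false | false = refl
... | true  | false = trans (sym (p I e)) f
... | false | true  = trans (sym e) (q I f)

⋁-upper : ∀ {m} {φ} {φs : List (Formula (Fin m))} → φ ∈ φs → φ ⊫ ⋁ φs
⋁-upper (here refl) I t rewrite t = refl
⋁-upper {φs = ψ ∷ _} (there p) I t with eval I ψ
... | true  = refl
... | false = ⋁-upper p I t

⋁-least : ∀ {m} ψ (φs : List (Formula (Fin m))) → (∀ φ → φ ∈ φs → φ ⊫ ψ) → ⋁ φs ⊫ ψ
⋁-least ψ []       h I ()
⋁-least ψ (φ ∷ φs) h I t with eval I φ in e
... | true  = h φ (here refl) I e
... | false = ⋁-least ψ φs (λ χ → h χ ∘ there) I t

⋀-lower : ∀ {m} {φ} {φs : List (Formula (Fin m))} → φ ∈ φs → ⋀ φs ⊫ φ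
⋀-lower {φ = φ} (here refl) I t with eval I φ
... | true = refl
⋀-lower {φs = ψ ∷ _} (there p) I t with eval I ψ
... | true = ⋀-lower p I t

⋀-greatest : ∀ {m} ψ (φs : List (Formula (Fin m))) → (∀ φ → φ ∈ φs → ψ ⊫ φ) → ψ ⊫ ⋀ φs
⋀-greatest ψ []       h I t = refl
⋀-greatest ψ (φ ∷ φs) h I t rewrite h φ (here refl) I t = ⋀-greatest ψ φs (λ χ → h χ ∘ there) I t

-- The lattice Lᵈₚ of maps Σ_d → Lₚ, with Σ_p = Fin m and Σ_d = Fin n.
-- An equivalence class is given by a representative; equality is _≋_.

Assignment : ℕ → ℕ → Set
Assignment m n = Fin n → Formula (Fin m)

Lᵈₚ-poset : ℕ → ℕ → Poset 0ℓ 0ℓ 0ℓ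
Lᵈₚ-poset m n = record
  { Carrier = Assignment m n
  ; _≈_     = λ 𝒜 ℬ → ∀ q → 𝒜 q ≋ ℬ q
  ; _≤_     = λ 𝒜 ℬ → ∀ q → 𝒜 q ⊫ ℬ q
  ; isPartialOrder = record
    { isPreorder = record
      { isEquivalence = record
        { refl  = λ q I → refl
        ; sym   = λ e q I → sym (e q I)
        ; trans = λ e f q I → trans (e q I) (f q I)
        }
      ; reflexive = λ {𝒜} {ℬ} e q → ≋⇒⊫ (𝒜 q) (ℬ q) (e q)
      ; trans     = λ p r q I → r q I ∘ p q I
      }
    ; antisym = λ {𝒜} {ℬ} p r q → ⊫-antisym (𝒜 q) (ℬ q) (p q) (r q)
    }
  }

-- Lₚ is finite: `formulas m` lists a representative of every class, obtained
-- by Shannon expansion.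

rename : ∀ {A B} → (A → B) → Formula A → Formula B
rename f (atom a) = atom (f a)
rename f ⊤        = ⊤
rename f ⊥        = ⊥
rename f (φ ∧ ψ)  = rename f φ ∧ rename f ψ
rename f (φ ∨ ψ)  = rename f φ ∨ rename f ψ
rename f (¬ φ)    = ¬ rename f φ

eval-rename-suc : ∀ {m} b (I : Subset m) φ → eval (b ∷ I) (rename suc φ) ≡ eval I φ
eval-rename-suc b I (atom a) = refl
eval-rename-suc b I ⊤        = refl
eval-rename-suc b I ⊥        = refl
eval-rename-suc b I (φ ∧ ψ)  = cong₂ Bool._∧_ (eval-rename-suc b I φ) (eval-rename-suc b I ψ)
eval-rename-suc b I (φ ∨ ψ)  = cong₂ Bool._∨_ (eval-rename-suc b I φ) (eval-rename-suc b I ψ)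
eval-rename-suc b I (¬ φ)    = cong Bool.not (eval-rename-suc b I φ)

shannon : ∀ {m} → Formula (Fin m) → Formula (Fin m) → Formula (Fin (suc m))
shannon φ ψ = (¬ atom zero ∨ rename suc φ) ∧ (atom zero ∨ rename suc ψ)

formulas : ∀ m → List (Formula (Fin m))
formulas zero    = ⊤ ∷ ⊥ ∷ []
formulas (suc m) = cartesianProductWith shannon (formulas m) (formulas m)

formulas-complete : ∀ m (f : Subset m → Bool) → ∃ λ φ → φ ∈ formulas m × (∀ I → f I ≡ eval I φ)
formulas-complete zero f with f [] in e
... | true  = ⊤ , here refl , λ { [] → e }
... | false = ⊥ , there (here refl) , λ { [] → e }
formulas-complete (suc m) f
  with formulas-complete m (f ∘ (true ∷_)) | formulas-complete m (f ∘ (false ∷_))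
... | φ , φ∈ , p | ψ , ψ∈ , r = shannon φ ψ , ∈-cartesianProductWith⁺ shannon φ∈ ψ∈ , correct
  where
  correct : ∀ I → f I ≡ eval I (shannon φ ψ)
  correct (false ∷ I) = trans (r I) (sym (eval-rename-suc false I ψ))
  correct (true ∷ I) rewrite eval-rename-suc true I φ | p I with eval I φ
  ... | true  = refl
  ... | false = refl

assignments : ∀ m n → List (Assignment m n)
assignments m zero    = (λ ()) ∷ []
assignments m (suc n) = cartesianProductWith F._∷_ (formulas m) (assignments m n)

assignments-complete : ∀ m n (𝒜 : Assignment m n) →
                       ∃ λ ℬ → ℬ ∈ assignments m n × (∀ q → 𝒜 q ≋ ℬ q)
assignments-complete m zero    𝒜 = (λ ()) , here refl , λ ()
assignments-complete m (suc n) 𝒜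
  with formulas-complete m (λ I → eval I (𝒜 zero)) | assignments-complete m n (𝒜 ∘ suc)
... | φ , φ∈ , p | ℬ , ℬ∈ , r =
  φ F.∷ ℬ , ∈-cartesianProductWith⁺ F._∷_ φ∈ ℬ∈ , λ { zero → p ; (suc q) → r q }

Lᵈₚ : ℕ → ℕ → CompleteLattice
Lᵈₚ m n = record { poset = Lᵈₚ-poset m n ; supremum = sup ; infimum = inf }
  where
  open Poset (Lᵈₚ-poset m n) using (_≈_)

  module _ {S : Pred (Assignment m n) 0ℓ} (S? : Decidable S) (resp : S Respects _≈_) where

    values : Fin n → List (Formula (Fin m))
    values q = map (λ 𝒜 → 𝒜 q) (filter S? (assignments m n))

    member : ∀ 𝒜 → S 𝒜 → ∀ q → ∃ λ φ → φ ∈ values q × 𝒜 q ≋ φ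
    member 𝒜 s q with assignments-complete m n 𝒜
    ... | ℬ , ℬ∈ , e = ℬ q , ∈-map⁺ (λ 𝒜 → 𝒜 q) (∈-filter⁺ S? ℬ∈ (resp e s)) , e q

    origin : ∀ q φ → φ ∈ values q → ∃ λ 𝒜 → S 𝒜 × φ ≡ 𝒜 q
    origin q φ φ∈ with ∈-map⁻ (λ 𝒜 → 𝒜 q) φ∈
    ... | 𝒜 , 𝒜∈ , e = 𝒜 , proj₂ (∈-filter⁻ S? {xs = assignments m n} 𝒜∈) , e

    sup : ∃ (IsSupremum (Lᵈₚ-poset m n) S)
    sup = ⋁ ∘ values , upper , least
      where
      upper : ∀ 𝒜 → S 𝒜 → ∀ q → 𝒜 q ⊫ ⋁ (values q)
      upper 𝒜 s q I t with member 𝒜 s q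
      ... | φ , φ∈ , e = ⋁-upper φ∈ I (≋⇒⊫ (𝒜 q) φ e I t)

      least : ∀ ℬ → (∀ 𝒜 → S 𝒜 → ∀ q → 𝒜 q ⊫ ℬ q) → ∀ q → ⋁ (values q) ⊫ ℬ q
      least ℬ h q = ⋁-least (ℬ q) (values q) bound
        where
        bound : ∀ φ → φ ∈ values q → φ ⊫ ℬ q
        bound φ φ∈ with origin q φ φ∈
        ... | 𝒜 , s , refl = h 𝒜 s q

    inf : ∃ (IsInfimum (Lᵈₚ-poset m n) S)
    inf = ⋀ ∘ values , lower , greatest
      where
      lower : ∀ 𝒜 → S 𝒜 → ∀ q → ⋀ (values q) ⊫ 𝒜 q
      lower 𝒜 s q I t with member 𝒜 s q
      ... | φ , φ∈ , e = trans (e I) (⋀-lower φ∈ I t)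

      greatest : ∀ ℬ → (∀ 𝒜 → S 𝒜 → ∀ q → ℬ q ⊫ 𝒜 q) → ∀ q → ℬ q ⊫ ⋀ (values q)
      greatest ℬ h q = ⋀-greatest (ℬ q) (values q) bound
        where
        bound : ∀ φ → φ ∈ values q → ℬ q ⊫ φ
        bound φ φ∈ with origin q φ φ∈
        ... | 𝒜 , s , refl = h 𝒜 s q

-- Σ = Σ_p ∪ Σ_d, a disjoint union.
Alphabet : ℕ → ℕ → Set
Alphabet m n = Fin m ⊎ Fin n

data Literal (A : Set) : Set where
  pos neg : A → Literal A

literal : ∀ {A} → Literal A → Formula A
literal (pos a) = atom a
literal (neg a) = ¬ atom a

record Rule (m n : ℕ) : Set where
  constructor _⟵_
  field
    head : Fin n
    body : List (Literal (Alphabet m n))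

  bodyFormula : Formula (Alphabet m n)
  bodyFormula = ⋀ (map literal body)

open Rule public

Program : ℕ → ℕ → Set
Program m n = List (Rule m n)

definition : ∀ {m n} → Program m n → Fin n → Formula (Alphabet m n)
definition P q = ⋁ (map bodyFormula (filter (λ r → head r Fin.≟ q) P))

⟦_⟧ : ∀ {m n} → Formula (Alphabet m n) → Assignment m n × Assignment m n →
      Formula (Fin m) × Formula (Fin m)
⟦ atom (inj₁ q) ⟧ S         = atom q , atom q
⟦ atom (inj₂ q) ⟧ (𝒜ₜ , 𝒜ₚ) = 𝒜ₜ q , 𝒜ₚ q
⟦ ⊤ ⟧     S = ⊤ , ⊤
⟦ ⊥ ⟧     S = ⊥ , ⊥
⟦ φ ∧ ψ ⟧ S = proj₁ (⟦ φ ⟧ S) ∧ proj₁ (⟦ ψ ⟧ S) , proj₂ (⟦ φ ⟧ S) ∧ proj₂ (⟦ ψ ⟧ S)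
⟦ φ ∨ ψ ⟧ S = proj₁ (⟦ φ ⟧ S) ∨ proj₁ (⟦ ψ ⟧ S) , proj₂ (⟦ φ ⟧ S) ∨ proj₂ (⟦ ψ ⟧ S)
⟦ ¬ φ ⟧   S = ¬ proj₂ (⟦ φ ⟧ S) , ¬ proj₁ (⟦ φ ⟧ S)

Ψ : ∀ {m n} → Program m n → Assignment m n × Assignment m n → Assignment m n × Assignment m n
Ψ P S = (λ q → proj₁ (⟦ definition P q ⟧ S)) , (λ q → proj₂ (⟦ definition P q ⟧ S))

-- On exact pairs the two components coincide, so 𝒯 below may select either.
⟦⟧-exact : ∀ {m n} (φ : Formula (Alphabet m n)) 𝒜 → proj₁ (⟦ φ ⟧ (𝒜 , 𝒜)) ≡ proj₂ (⟦ φ ⟧ (𝒜 , 𝒜))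
⟦⟧-exact (atom (inj₁ q)) 𝒜 = refl
⟦⟧-exact (atom (inj₂ q)) 𝒜 = refl
⟦⟧-exact ⊤       𝒜 = refl
⟦⟧-exact ⊥       𝒜 = refl
⟦⟧-exact (φ ∧ ψ) 𝒜 = cong₂ _∧_ (⟦⟧-exact φ 𝒜) (⟦⟧-exact ψ 𝒜)
⟦⟧-exact (φ ∨ ψ) 𝒜 = cong₂ _∨_ (⟦⟧-exact φ 𝒜) (⟦⟧-exact ψ 𝒜)
⟦⟧-exact (¬ φ)   𝒜 = cong ¬_ (sym (⟦⟧-exact φ 𝒜))

⟦⟧-cong : ∀ {m n} (φ : Formula (Alphabet m n)) {𝒜ₜ 𝒜ₚ ℬₜ ℬₚ : Assignment m n} →
          (∀ q → 𝒜ₜ q ≋ ℬₜ q) → (∀ q → 𝒜ₚ q ≋ ℬₚ q) →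
          proj₁ (⟦ φ ⟧ (𝒜ₜ , 𝒜ₚ)) ≋ proj₁ (⟦ φ ⟧ (ℬₜ , ℬₚ)) ×
          proj₂ (⟦ φ ⟧ (𝒜ₜ , 𝒜ₚ)) ≋ proj₂ (⟦ φ ⟧ (ℬₜ , ℬₚ))
⟦⟧-cong (atom (inj₁ q)) e f = (λ I → refl) , (λ I → refl)
⟦⟧-cong (atom (inj₂ q)) e f = e q , f q
⟦⟧-cong ⊤       e f = (λ I → refl) , (λ I → refl)
⟦⟧-cong ⊥       e f = (λ I → refl) , (λ I → refl)
⟦⟧-cong (φ ∧ ψ) e f with ⟦⟧-cong φ e f | ⟦⟧-cong ψ e f
... | p₁ , p₂ | r₁ , r₂ = (λ I → cong₂ Bool._∧_ (p₁ I) (r₁ I)) , (λ I → cong₂ Bool._∧_ (p₂ I) (r₂ I))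
⟦⟧-cong (φ ∨ ψ) e f with ⟦⟧-cong φ e f | ⟦⟧-cong ψ e f
... | p₁ , p₂ | r₁ , r₂ = (λ I → cong₂ Bool._∨_ (p₁ I) (r₁ I)) , (λ I → cong₂ Bool._∨_ (p₂ I) (r₂ I))
⟦⟧-cong (¬ φ)   e f with ⟦⟧-cong φ e f
... | p₁ , p₂ = (λ I → cong Bool.not (p₂ I)) , (λ I → cong Bool.not (p₁ I))

𝒯 : ∀ {m n} → Program m n → Operator (Lᵈₚ m n)
𝒯 P = record
  { to   = λ 𝒜 q → proj₁ (⟦ definition P q ⟧ (𝒜 , 𝒜))
  ; cong = λ e q → proj₁ (⟦⟧-cong (definition P q) e e)
  }

comprehension : ∀ {n} {Q : Pred (Fin n) 0ℓ} → Decidable Q → Subset n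
comprehension Q? = tabulate (does ∘ Q?)

π : ∀ {m n} → Subset m → Assignment m n → Subset n
π I 𝒜 = comprehension (λ a → eval I (𝒜 a) Bool.≟ true)

π-cong : ∀ {m n} (I : Subset m) {𝒜 ℬ : Assignment m n} → (∀ q → 𝒜 q ≋ ℬ q) → π I 𝒜 ≡ π I ℬ
π-cong I e = tabulate-cong (λ q → cong (λ b → does (b Bool.≟ true)) (e q I))

π² : ∀ {m n} → Subset m → Assignment m n × Assignment m n → Subset n × Subset n
π² I (𝒜₁ , 𝒜₂) = π I 𝒜₁ , π I 𝒜₂

-- Truth values are pairs (is true , is not false): Kleene's true, unknown and
-- false are (true , true), (false , true) and (false , false); (true , false)
-- arises only from inconsistent pairs of interpretations.
kleene : ∀ {m n} → Subset m → Subset n × Subset n → Formula (Alphabet m n) → Bool × Bool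
kleene I J         (atom (inj₁ q)) = lookup I q , lookup I q
kleene I (J₁ , J₂) (atom (inj₂ q)) = lookup J₁ q , lookup J₂ q
kleene I J ⊤       = true , true
kleene I J ⊥       = false , false
kleene I J (φ ∧ ψ) = proj₁ (kleene I J φ) Bool.∧ proj₁ (kleene I J ψ) ,
                     proj₂ (kleene I J φ) Bool.∧ proj₂ (kleene I J ψ)
kleene I J (φ ∨ ψ) = proj₁ (kleene I J φ) Bool.∨ proj₁ (kleene I J ψ) ,
                     proj₂ (kleene I J φ) Bool.∨ proj₂ (kleene I J ψ)
kleene I J (¬ φ)   = Bool.not (proj₂ (kleene I J φ)) , Bool.not (proj₁ (kleene I J φ))

Fitting : ∀ {m n} → Program m n → Subset m → Subset n × Subset n → Subset n × Subset n
Fitting P I J =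
  comprehension (λ q → any? (λ r → (head r Fin.≟ q) ×-dec (proj₁ (kleene I J (bodyFormula r)) Bool.≟ true)) P) ,
  comprehension (λ q → any? (λ r → (head r Fin.≟ q) ×-dec (proj₂ (kleene I J (bodyFormula r)) Bool.≟ true)) P)

{-# OPTIONS --safe #-}
-- Negation is antitone and swaps the two components of a pair, so evaluation
-- is ≤ₚ-monotone by structural induction; on exact pairs both components coincide.
-- Evaluating a formula of Lₚ in I is a Boolean homomorphism, hence ⟦ φ ⟧ S evaluates in I to
-- the Kleene value of φ at π² I S; a disjunction of bodies is true exactly when some body is.
module Submission where

open import Data.Bool as Bool using (Bool; true; false; not)
import Data.Fin as Fin
open import Data.List using ([]; _∷_)
open import Data.List.Relation.Unary.Any using (any?)
open import Data.Nat using (ℕ)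
open import Data.Product using (_×_; _,_; proj₁; proj₂)
open import Data.Fin.Subset using (Subset)
open import Data.Sum using (inj₁; inj₂)
open import Data.Vec using (lookup)
open import Data.Vec.Properties using (lookup∘tabulate; tabulate-cong)
open import Function using (_∘_)
open import Relation.Binary.PropositionalEquality using (_≗_; _≡_; refl; sym; trans; cong; cong₂)
open import Relation.Nullary using (does; _×-dec_)
open import Defs

∧-mono : ∀ {a b c d} → (a ≡ true → c ≡ true) → (b ≡ true → d ≡ true) →
         a Bool.∧ b ≡ true → c Bool.∧ d ≡ true
∧-mono {true} p r t rewrite p refl = r t

∨-mono : ∀ {a b c d} → (a ≡ true → c ≡ true) → (b ≡ true → d ≡ true) →
         a Bool.∨ b ≡ true → c Bool.∨ d ≡ true
∨-mono {true}              p r t rewrite p refl = refl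
∨-mono {false} {c = true}  p r t = refl
∨-mono {false} {c = false} p r t = r t

not-antitone : ∀ {a b} → (a ≡ true → b ≡ true) → not b ≡ true → not a ≡ true
not-antitone {false} p t = refl
not-antitone {true}  p t = trans (cong not (sym (p refl))) t

-- Both inclusions go through one induction because each half of the `¬` case draws on the opposite
-- half for the subformula.
⟦⟧-mono : ∀ {m n} (φ : Formula (Alphabet m n)) S S′ → CompleteLattice._≤ₚ_ (Lᵈₚ m n) S S′ →
          proj₁ (⟦ φ ⟧ S) ⊫ proj₁ (⟦ φ ⟧ S′) × proj₂ (⟦ φ ⟧ S′) ⊫ proj₂ (⟦ φ ⟧ S)
⟦⟧-mono (atom (inj₁ q)) S S′ _       = (λ _ t → t) , (λ _ t → t)
⟦⟧-mono (atom (inj₂ q)) S S′ (l , u) = l q , u q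
⟦⟧-mono ⊤       S S′ _ = (λ _ t → t) , (λ _ t → t)
⟦⟧-mono ⊥       S S′ _ = (λ _ t → t) , (λ _ t → t)
⟦⟧-mono (φ ∧ ψ) S S′ S≤S′ with ⟦⟧-mono φ S S′ S≤S′ | ⟦⟧-mono ψ S S′ S≤S′
... | l , u | l′ , u′ = (λ I → ∧-mono (l I) (l′ I)) , (λ I → ∧-mono (u I) (u′ I))
⟦⟧-mono (φ ∨ ψ) S S′ S≤S′ with ⟦⟧-mono φ S S′ S≤S′ | ⟦⟧-mono ψ S S′ S≤S′
... | l , u | l′ , u′ = (λ I → ∨-mono (l I) (l′ I)) , (λ I → ∨-mono (u I) (u′ I))
⟦⟧-mono (¬ φ)   S S′ S≤S′ with ⟦⟧-mono φ S S′ S≤S′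
... | l , u = (λ I → not-antitone (u I)) , (λ I → not-antitone (l I))

Ψ-isApproximator : ∀ {m n} (P : Program m n) → IsApproximator (Lᵈₚ m n) (Ψ P) (𝒯 P)
Ψ-isApproximator P = record
  { monotone = λ {S} {S′} S≤S′ → (λ q → proj₁ (⟦⟧-mono (definition P q) S S′ S≤S′)) ,
                                 (λ q → proj₂ (⟦⟧-mono (definition P q) S S′ S≤S′))
  -- `𝒯` selects the first component, so this bound is reflexivity; only `upper` has to cross to the
  -- second, by `⟦⟧-exact`.
  ; lower    = λ _ _ _ t → t
  ; upper    = λ 𝒜 q I t → trans (cong (eval I) (sym (⟦⟧-exact (definition P q) 𝒜))) t
  }

does-≟-true : ∀ b → does (b Bool.≟ true) ≡ b
does-≟-true true  = refl
does-≟-true false = refl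

lookup-π : ∀ {m n} (I : Subset m) (𝒜 : Assignment m n) q → lookup (π I 𝒜) q ≡ eval I (𝒜 q)
lookup-π I 𝒜 q = trans (lookup∘tabulate _ q) (does-≟-true (eval I (𝒜 q)))

-- `⟦_⟧` and `kleene` treat every connective alike, including the swap at `¬`, so only atoms of Σ_d
-- need an argument. Inconsistent pairs `S` are covered.
kleene-π² : ∀ {m n} (I : Subset m) S (φ : Formula (Alphabet m n)) →
            kleene I (π² I S) φ ≡ (eval I (proj₁ (⟦ φ ⟧ S)) , eval I (proj₂ (⟦ φ ⟧ S)))
kleene-π² I S (atom (inj₁ q))         = refl
kleene-π² I (𝒜₁ , 𝒜₂) (atom (inj₂ q)) = cong₂ _,_ (lookup-π I 𝒜₁ q) (lookup-π I 𝒜₂ q)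
kleene-π² I S ⊤       = refl
kleene-π² I S ⊥       = refl
kleene-π² I S (φ ∧ ψ) rewrite kleene-π² I S φ | kleene-π² I S ψ = refl
kleene-π² I S (φ ∨ ψ) rewrite kleene-π² I S φ | kleene-π² I S ψ = refl
kleene-π² I S (¬ φ)   rewrite kleene-π² I S φ = refl

-- Abstracting the valuation `v` lets one induction serve both Kleene components; bodies stay
-- opaque, since `definition` adds only `⊥` and `∨` around them.
any-body≡definition : ∀ {m n} (v : Formula (Alphabet m n) → Bool) →
  v ⊥ ≡ false → (∀ φ ψ → v (φ ∨ ψ) ≡ v φ Bool.∨ v ψ) → ∀ P q →
  does (any? (λ r → (head r Fin.≟ q) ×-dec (v (bodyFormula r) Bool.≟ true)) P) ≡ v (definition P q)
any-body≡definition v v-⊥ v-∨ []      q = sym v-⊥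
-- The filter inside `definition` and the search by `any?` branch on this same Boolean, so both
-- sides reduce together.
any-body≡definition v v-⊥ v-∨ (r ∷ P) q with does (head r Fin.≟ q)
... | false = any-body≡definition v v-⊥ v-∨ P q
... | true  = trans (cong₂ Bool._∨_ (does-≟-true _) (any-body≡definition v v-⊥ v-∨ P q))
                    (sym (v-∨ _ _))

Fitting-π² : ∀ {m n} (P : Program m n) I → Fitting P I ∘ π² I ≗ π² I ∘ Ψ P
Fitting-π² P I S = cong₂ _,_
  -- Pointwise in `q`: some body true, then the Kleene value of `definition P q`, then its
  -- evaluation in `I`, then the membership test of `π`.
  (tabulate-cong λ q → trans
    (any-body≡definition (proj₁ ∘ kleene I (π² I S)) refl (λ _ _ → refl) P q)
    (trans (cong proj₁ (kleene-π² I S (definition P q))) (sym (does-≟-true _))))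
  (tabulate-cong λ q → trans
    (any-body≡definition (proj₂ ∘ kleene I (π² I S)) refl (λ _ _ → refl) P q)
    (trans (cong proj₂ (kleene-π² I S (definition P q))) (sym (does-≟-true _))))

theorem4p9 : (m n : ℕ) (P : Program m n) →
    IsApproximator (Lᵈₚ m n) (Ψ P) (𝒯 P)
    × ((I : Subset m) → Fitting P I ∘ π² I ≗ π² I ∘ Ψ P)
theorem4p9 m n P = Ψ-isApproximator P , Fitting-π² P
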